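{- For every integer $r\ge 2$ there exists a finite hypergraph $H$ with maximum edge size $r$ such that $H$ is linear, $2$-regular and bipartite, no edge of $H$ consists of a twin set, and there is no weighting $\rho:E(H)\to\{1,2,\ldots,r\}$ for which the induced vertex weights $\rho(v):=\sum_{e\in E(H),\, e\ni v}\rho(e)$, $v\in V(H)$, properly color $V(H)$.
   Context: A hypergraph $H$ consists of a vertex set $V(H)$ and a collection $E(H)$ of subsets of $V(H)$, called edges; multiple edges are in general allowed. Edges need not have the same size. A function on $V(H)$ properly colors $V(H)$ if no edge is monochromatic, i.e. every edge contains at least two vertices with different values. A hypergraph is bipartite if it has a proper coloring with $2$ colors. It is linear if any two distinct edges intersect in at most one vertex. It is $2$-regular if every vertex lies in exactly two edges. A set of vertices of any cardinality is called a twin set if all vertices in the set are contained in exactly the same set of edges; an edge consists of a twin set if its vertex set is a twin set. -}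

module Defs where

open import Data.Nat using (ℕ; _≤_)
open import Data.Nat.ListAction using (sum)
open import Data.Fin using (Fin)
open import Data.Fin.Subset using (Subset; _∈_; _∩_; ∣_∣)
open import Data.Fin.Subset.Properties using (_∈?_)
open import Data.List using (List; allFin; filter; length; map)
open import Data.Product using (_×_; ∃-syntax; Σ-syntax)
open import Function.Bundles using (_⇔_)
open import Relation.Binary.PropositionalEquality using (_≡_; _≢_)

-- Edges are an indexed family, so that multiple edges are allowed: distinct
-- edges are distinct indices, possibly with the same vertex set.
record Hypergraph : Set where
  field
    #V   : ℕ
    #E   : ℕ
    edge : Fin #E → Subset #V

  Vertex : Set
  Vertex = Fin #V

  Edge : Set
  Edge = Fin #E

  edgesAt : Vertex → List Edge
  edgesAt v = filter (λ e → v ∈? edge e) (allFin #E)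

  degree : Vertex → ℕ
  degree v = length (edgesAt v)

  -- Empty and one-vertex edges count as monochromatic.
  ProperlyColors : {A : Set} → (Vertex → A) → Set
  ProperlyColors c =
    ∀ e → ∃[ u ] ∃[ v ] (u ∈ edge e × v ∈ edge e × c u ≢ c v)

  Bipartite : Set
  Bipartite = Σ[ c ∈ (Vertex → Fin 2) ] ProperlyColors c

  Linear : Set
  Linear = ∀ (e f : Edge) → e ≢ f → ∣ edge e ∩ edge f ∣ ≤ 1

  Regular : ℕ → Set
  Regular d = ∀ v → degree v ≡ d

  MaxEdgeSize : ℕ → Set
  MaxEdgeSize r = (∀ e → ∣ edge e ∣ ≤ r) × ∃[ e ] (∣ edge e ∣ ≡ r)

  TwinSet : Subset #V → Set
  TwinSet S = ∀ u v → u ∈ S → v ∈ S → ∀ e → u ∈ edge e ⇔ v ∈ edge e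

  IsWeighting : ℕ → (Edge → ℕ) → Set
  IsWeighting r ρ = ∀ e → 1 ≤ ρ e × ρ e ≤ r

  vertexWeight : (Edge → ℕ) → Vertex → ℕ
  vertexWeight ρ v = sum (map ρ (edgesAt v))

{-# OPTIONS --safe #-}
-- Subdivide every edge of K_{r+1} once and take the dual hypergraph: its
-- vertices are the half-edges of K_{r+1}, its edges are the stars (r half-edges
-- each) and the pairs of halves of one edge. A half-edge has weight ρ(star) +
-- ρ(pair), so a pair is monochromatic as soon as its two stars have equal weight,
-- and by pigeonhole r weights cannot separate r + 1 stars. Orienting K_{r+1} as a
-- tournament without sources and sinks, the tail and head halves of the arcs form
-- a proper 2-colouring.
module Submission where

open import Data.Nat using (ℕ; suc; pred; NonZero; >-nonZero; _+_; _*_; _≤_; _<_; z≤n; s≤s)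
open import Data.Nat.ListAction.Properties using (sum-↭)
open import Data.Nat.Properties as ℕ using (≤-reflexive; ≤-trans; n<1+n; suc-pred; +-identityʳ)
open import Data.Fin as Fin using (Fin; zero; suc; _≟_; _↑ˡ_; _↑ʳ_; splitAt; combine; remQuot; punchIn; punchOut; fromℕ<)
open import Data.Fin.Properties as Fin using
  ( splitAt-↑ˡ; splitAt-↑ʳ; splitAt⁻¹-↑ˡ; splitAt⁻¹-↑ʳ; remQuot-combine; combine-remQuot
  ; punchIn-injective; punchInᵢ≢i; punchIn-punchOut; pigeonhole; fromℕ<-injective )
open import Data.Fin.Subset using (Subset; _∈_; _-_; ∣_∣; ⁅_⁆; inside; outside)
open import Data.Fin.Subset.Properties using
  ( _∈?_; nonempty?; p─⊥≡p; p─q⊆p; x∈p∧x≢y⇒x∈p-y; x∈p∩q⁻; ∣⊥∣≡0; ∣⁅x⁆∣≡1; x∈⁅x⁆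
  ; p⊆q⇒∣p∣≤∣q∣; Empty-unique )
open import Data.List using (List; []; _∷_; allFin; cartesianProduct; filter; length; lookup; map)
open import Data.List.Membership.Propositional as List using ()
open import Data.List.Membership.Propositional.Properties using
  (∈-allFin; ∈-cartesianProduct⁺; ∈-filter⁺; ∈-filter⁻; ∈-lookup; ∈-map⁺; ∈-map⁻)
open import Data.List.Membership.Propositional.Properties.WithK using (unique∧set⇒bag)
open import Data.List.Properties using (length-map; length-tabulate)
open import Data.List.Relation.Binary.BagAndSetEquality using (∼bag⇒↭)
open import Data.List.Relation.Binary.Permutation.Propositional using (_↭_)
open import Data.List.Relation.Binary.Permutation.Propositional.Properties using (↭-length; map⁺)
open import Data.List.Relation.Unary.All as All using ([]; _∷_)
open import Data.List.Relation.Unary.AllPairs using ([]; _∷_)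
open import Data.List.Relation.Unary.Any using (here; there; index)
open import Data.List.Relation.Unary.Any.Properties using (lookup-index)
open import Data.List.Relation.Unary.Unique.Propositional using (Unique)
open import Data.List.Relation.Unary.Unique.Propositional.Properties as Unique using (allFin⁺)
open import Data.Product using (_×_; _,_; ∃-syntax; ∃₂; Σ-syntax; proj₁; proj₂; swap; uncurry)
open import Data.Sum using (_⊎_; inj₁; inj₂; [_,_]′)
open import Data.Vec using (_∷_; here; there; tabulate)
open import Data.Vec.Properties using (lookup∘tabulate; lookup⇒[]=; []=⇒lookup)
open import Function using (_∘_; id; _⇔_; mk⇔; Equivalence)
open import Relation.Binary using (Decidable; tri<; tri≈; tri>)
open import Relation.Binary.PropositionalEquality
  using (_≡_; _≢_; refl; sym; trans; cong; cong₂; subst; module ≡-Reasoning)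
open import Relation.Nullary using (¬_; yes; no; does; contradiction)
open import Relation.Nullary.Decidable using (dec-true)
open import Defs

open Equivalence using (to; from)

private
  variable
    A : Set
    k m n : ℕ

-- Sizes of finite subsets, and fibres.

lookup-injective : {xs : List A} → Unique xs → ∀ i j → lookup xs i ≡ lookup xs j → i ≡ j
lookup-injective (_ ∷ _)  zero    zero    _  = refl
lookup-injective (x∉ ∷ _) zero    (suc j) eq = contradiction eq (All.lookup x∉ (∈-lookup j))
lookup-injective (x∉ ∷ _) (suc i) zero    eq = contradiction (sym eq) (All.lookup x∉ (∈-lookup i))
lookup-injective (_ ∷ u)  (suc i) (suc j) eq = cong suc (lookup-injective u i j eq)

x∈p⇒∣p∣≡1+∣p-x∣ : {p : Subset n} {x : Fin n} → x ∈ p → ∣ p ∣ ≡ suc ∣ p - x ∣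
x∈p⇒∣p∣≡1+∣p-x∣ {p = _ ∷ p}          here      = cong (suc ∘ ∣_∣) (sym (p─⊥≡p p))
x∈p⇒∣p∣≡1+∣p-x∣ {p = inside  ∷ p} (there x) = cong suc (x∈p⇒∣p∣≡1+∣p-x∣ x)
x∈p⇒∣p∣≡1+∣p-x∣ {p = outside ∷ p} (there x) = x∈p⇒∣p∣≡1+∣p-x∣ x

x∉p-x : (p : Subset n) (x : Fin n) → ¬ x ∈ p - x
x∉p-x (_ ∷ p) zero    ()
x∉p-x (_ ∷ p) (suc x) (there x∈) = x∉p-x p x x∈

-- Induction on the list: its head lies in `p`, and removing it from `p` leaves a subset that the
-- tail enumerates. Computing an edge size thus reduces to listing the edge without repetition.
∣p∣≡length : {p : Subset n} {xs : List (Fin n)} → Unique xs →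
             (∀ x → x ∈ p ⇔ x List.∈ xs) → ∣ p ∣ ≡ length xs
∣p∣≡length {n} {p} {[]} _ p≈[] =
  trans (cong ∣_∣ (Empty-unique λ (x , x∈p) → empty (to (p≈[] x) x∈p))) (∣⊥∣≡0 n)
  where
  empty : ∀ {x} → ¬ x List.∈ []
  empty ()
∣p∣≡length {n} {p} {x ∷ xs} (x∉xs ∷ u) p≈xs =
  trans (x∈p⇒∣p∣≡1+∣p-x∣ (from (p≈xs x) (here refl)))
        (cong suc (∣p∣≡length u λ y → mk⇔ (forward y) (backward y)))
  where
  forward : ∀ y → y ∈ p - x → y List.∈ xs
  forward y y∈ with to (p≈xs y) (p─q⊆p p ⁅ x ⁆ y∈)
  ... | here refl = contradiction y∈ (x∉p-x p x)
  ... | there y∈xs = y∈xs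
  backward : ∀ y → y List.∈ xs → y ∈ p - x
  backward y y∈ = x∈p∧x≢y⇒x∈p-y (from (p≈xs y) (there y∈)) (All.lookup x∉xs y∈ ∘ sym)

∣p∣≤1 : {p : Subset n} → (∀ {x y} → x ∈ p → y ∈ p → x ≡ y) → ∣ p ∣ ≤ 1
∣p∣≤1 {n} {p} prop with nonempty? p
... | yes (x , x∈p) = ≤-trans (p⊆q⇒∣p∣≤∣q∣ λ y∈p → subst (_∈ ⁅ x ⁆) (prop x∈p y∈p) (x∈⁅x⁆ x))
                              (≤-reflexive (∣⁅x⁆∣≡1 x))
... | no empty = ≤-trans (≤-reflexive (trans (cong ∣_∣ (Empty-unique empty)) (∣⊥∣≡0 n))) z≤n

fibre : (Fin m → Fin n) → Fin n → Subset m
fibre h i = tabulate λ v → does (h v ≟ i)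

module _ (h : Fin m → Fin n) {i : Fin n} {v : Fin m} where

  ∈-fibre⁺ : h v ≡ i → v ∈ fibre h i
  ∈-fibre⁺ eq = lookup⇒[]= v _ (trans (lookup∘tabulate _ v) (dec-true (h v ≟ i) eq))

  ∈-fibre⁻ : v ∈ fibre h i → h v ≡ i
  ∈-fibre⁻ v∈ with h v ≟ i | trans (sym (lookup∘tabulate (λ w → does (h w ≟ i)) v)) ([]=⇒lookup v∈)
  ... | yes eq | _  = eq
  ... | no _   | ()

-- Duals of bipartite graphs.

-- The dual of the bipartite graph with sides Fin k and Fin l whose edge v joins
-- f v and g v.
module Dual {k l m : ℕ} (f : Fin m → Fin k) (g : Fin m → Fin l) where

  H : Hypergraph
  H = record
    { #V   = m
    ; #E   = k + l
    ; edge = λ e → [ fibre f , fibre g ]′ (splitAt k e)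
    }

  open Hypergraph H

  left right : Fin m → Edge
  left  v = f v ↑ˡ l
  right v = k ↑ʳ g v

  ∈-edge-↑ˡ : ∀ {v i} → v ∈ edge (i ↑ˡ l) ⇔ f v ≡ i
  ∈-edge-↑ˡ {i = i} rewrite splitAt-↑ˡ k i l = mk⇔ (∈-fibre⁻ f) (∈-fibre⁺ f)

  ∈-edge-↑ʳ : ∀ {v j} → v ∈ edge (k ↑ʳ j) ⇔ g v ≡ j
  ∈-edge-↑ʳ {j = j} rewrite splitAt-↑ʳ k l j = mk⇔ (∈-fibre⁻ g) (∈-fibre⁺ g)

  ∈-edge⁻ : ∀ {v} e → v ∈ edge e → e ≡ left v ⊎ e ≡ right v
  ∈-edge⁻ e v∈ with splitAt k e in eq
  ... | inj₁ i = inj₁ (trans (sym (splitAt⁻¹-↑ˡ eq)) (cong (_↑ˡ l) (sym (∈-fibre⁻ f v∈))))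
  ... | inj₂ j = inj₂ (trans (sym (splitAt⁻¹-↑ʳ {m = k} eq)) (cong (k ↑ʳ_) (sym (∈-fibre⁻ g v∈))))

  left≢right : ∀ v → left v ≢ right v
  left≢right v eq with trans (sym (splitAt-↑ˡ k (f v) l))
                             (trans (cong (splitAt k) eq) (splitAt-↑ʳ k l (g v)))
  ... | ()

  -- Two duplicate-free lists with the same members are permutations of each other. Both the degree
  -- and the vertex weight are read off from the two-element list.
  edgesAt-↭ : ∀ v → edgesAt v ↭ left v ∷ right v ∷ []
  edgesAt-↭ v = ∼bag⇒↭ (unique∧set⇒bag
    (Unique.filter⁺ v∈? (allFin⁺ (k + l)))
    ((left≢right v ∷ []) ∷ [] ∷ [])
    (mk⇔ forward backward))
    where
    v∈? = λ e → v ∈? edge e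
    forward : ∀ {e} → e List.∈ edgesAt v → e List.∈ left v ∷ right v ∷ []
    forward {e} e∈ with ∈-edge⁻ e (proj₂ (∈-filter⁻ v∈? {xs = allFin (k + l)} e∈))
    ... | inj₁ eq = here eq
    ... | inj₂ eq = there (here eq)
    backward : ∀ {e} → e List.∈ left v ∷ right v ∷ [] → e List.∈ edgesAt v
    backward (here refl)         = ∈-filter⁺ v∈? (∈-allFin _) (from ∈-edge-↑ˡ refl)
    backward (there (here refl)) = ∈-filter⁺ v∈? (∈-allFin _) (from ∈-edge-↑ʳ refl)

  regular : Regular 2
  regular v = ↭-length (edgesAt-↭ v)

  vertexWeight-≡ : ∀ ρ v → vertexWeight ρ v ≡ ρ (left v) + ρ (right v)
  vertexWeight-≡ ρ v = trans (sum-↭ (map⁺ ρ (edgesAt-↭ v)))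
                             (cong (ρ (left v) +_) (+-identityʳ _))

  properlyColors : (c : Vertex → A) →
                   (∀ i → ∃₂ λ u v → f u ≡ i × f v ≡ i × c u ≢ c v) →
                   (∀ j → ∃₂ λ u v → g u ≡ j × g v ≡ j × c u ≢ c v) →
                   ProperlyColors c
  properlyColors c cf cg e with splitAt k e
  ... | inj₁ i = let u , v , fu , fv , u≢v = cf i in u , v , ∈-fibre⁺ f fu , ∈-fibre⁺ f fv , u≢v
  ... | inj₂ j = let u , v , gu , gv , u≢v = cg j in u , v , ∈-fibre⁺ g gu , ∈-fibre⁺ g gv , u≢v

  -- `simple` says that the bipartite graph has no parallel edges.
  module _ (simple : ∀ {u v} → f u ≡ f v → g u ≡ g v → u ≡ v) where

    -- Distinct fibres of one map are disjoint, so two distinct edges can share a vertex only if one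
    -- is a fibre of `f` and the other a fibre of `g`; `simple` then determines that vertex.
    linear : Linear
    linear d e d≢e = ∣p∣≤1 λ x∈ y∈ →
      let x∈d , x∈e = x∈p∩q⁻ (edge d) (edge e) x∈
          y∈d , y∈e = x∈p∩q⁻ (edge d) (edge e) y∈
      in meet x∈d x∈e y∈d y∈e
      where
      meet : ∀ {x y} → x ∈ edge d → x ∈ edge e → y ∈ edge d → y ∈ edge e → x ≡ y
      meet x∈d x∈e y∈d y∈e with ∈-edge⁻ d x∈d | ∈-edge⁻ e x∈e
      ... | inj₁ refl | inj₁ refl = contradiction refl d≢e
      ... | inj₂ refl | inj₂ refl = contradiction refl d≢e
      ... | inj₁ refl | inj₂ refl = sym (simple (to ∈-edge-↑ˡ y∈d) (to ∈-edge-↑ʳ y∈e))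
      ... | inj₂ refl | inj₁ refl = sym (simple (to ∈-edge-↑ˡ y∈e) (to ∈-edge-↑ʳ y∈d))

    -- A proper colouring supplies differently coloured `u` and `v` in `e`. As twins they would
    -- share both the left and the right edge, and `simple` would identify them.
    no-twins : Bipartite → ∀ e → ¬ TwinSet (edge e)
    no-twins (c , proper) e twin with proper e
    ... | u , v , u∈ , v∈ , cu≢cv with to (twin u v u∈ v∈ (left u)) (from ∈-edge-↑ˡ refl)
                                    | to (twin u v u∈ v∈ (right u)) (from ∈-edge-↑ʳ refl)
    ... | v∈l | v∈r = cu≢cv (cong c (sym (simple (to ∈-edge-↑ˡ v∈l) (to ∈-edge-↑ʳ v∈r))))

  -- All vertices of a right edge receive the same summand from that edge, so their weights agree
  -- once their left edges do. The hypothesis provides such a right edge for any labelling of the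
  -- left side by `r` labels.
  no-weighting : ∀ {r} →
                 (∀ (h : Fin k → Fin r) → ∃[ j ] (∀ u v → g u ≡ j → g v ≡ j → h (f u) ≡ h (f v))) →
                 ¬ (Σ[ ρ ∈ (Edge → ℕ) ] (IsWeighting r ρ × ProperlyColors (vertexWeight ρ)))
  no-weighting {r} mono (ρ , bounded , proper) =
    let j , constant = mono h
        u , v , u∈ , v∈ , wu≢wv = proper (k ↑ʳ j)
        gu = to ∈-edge-↑ʳ u∈
        gv = to ∈-edge-↑ʳ v∈
    in wu≢wv (begin
      vertexWeight ρ u        ≡⟨ vertexWeight-≡ ρ u ⟩
      ρ (left u) + ρ (right u) ≡⟨ cong₂ _+_ (h-injective (f u) (f v) (constant u v gu gv))
                                            (cong (ρ ∘ (k ↑ʳ_)) (trans gu (sym gv))) ⟩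
      ρ (left v) + ρ (right v) ≡⟨ vertexWeight-≡ ρ v ⟨
      vertexWeight ρ v        ∎)
    where
    open ≡-Reasoning
    instance
      ρ-nonZero : ∀ {e} → NonZero (ρ e)
      ρ-nonZero {e} = >-nonZero (proj₁ (bounded e))
    -- Weights range over 1 to `r`; lowering them by one gives labels in `Fin r`, and positivity
    -- ensures that no two weights are merged.
    pred< : ∀ i → pred (ρ (i ↑ˡ l)) < r
    pred< i = subst (_≤ r) (sym (suc-pred (ρ (i ↑ˡ l)))) (proj₂ (bounded (i ↑ˡ l)))
    h : Fin k → Fin r
    h i = fromℕ< (pred< i)
    h-injective : ∀ i i′ → h i ≡ h i′ → ρ (i ↑ˡ l) ≡ ρ (i′ ↑ˡ l)
    h-injective i i′ eq = trans (sym (suc-pred (ρ (i ↑ˡ l))))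
      (trans (cong suc (fromℕ<-injective _ _ (pred< i) (pred< i′) eq)) (suc-pred (ρ (i′ ↑ˡ l))))

-- The tournament.

-- A tournament without sources and sinks: the 3-cycle 0 → 1 → 2 → 0 with the
-- vertex 2 blown up to a transitive tournament.
data _⇒_ {k} : Fin (3 + k) → Fin (3 + k) → Set where
  0⇒1 : zero ⇒ suc zero
  1⇒2 : ∀ {x} → suc zero ⇒ suc (suc x)
  2⇒0 : ∀ {x} → suc (suc x) ⇒ zero
  2⇒2 : ∀ {x y} → x Fin.< y → suc (suc x) ⇒ suc (suc y)

_⇒?_ : Decidable (_⇒_ {k})
zero        ⇒? zero        = no λ ()
zero        ⇒? suc zero    = yes 0⇒1
zero        ⇒? suc (suc y) = no λ ()
suc zero    ⇒? zero        = no λ ()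
suc zero    ⇒? suc zero    = no λ ()
suc zero    ⇒? suc (suc y) = yes 1⇒2
suc (suc x) ⇒? zero        = yes 2⇒0
suc (suc x) ⇒? suc zero    = no λ ()
suc (suc x) ⇒? suc (suc y) with x Fin.<? y
... | yes x<y = yes (2⇒2 x<y)
... | no  x≮y = no λ { (2⇒2 x<y) → x≮y x<y }

-- Only two arcs inside the blown-up part could be opposite, and there arcs follow the strict order.
⇒-asym : {i j : Fin (3 + k)} → i ⇒ j → ¬ j ⇒ i
⇒-asym (2⇒2 x<y) (2⇒2 y<x) = ℕ.<-asym x<y y<x

⇒-irrefl : {i : Fin (3 + k)} → ¬ i ⇒ i
⇒-irrefl i⇒i = ⇒-asym i⇒i i⇒i

⇒-total : (i j : Fin (3 + k)) → i ≢ j → i ⇒ j ⊎ j ⇒ i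
⇒-total zero        zero        i≢j = contradiction refl i≢j
⇒-total zero        (suc zero)  _   = inj₁ 0⇒1
⇒-total zero        (suc (suc _)) _ = inj₂ 2⇒0
⇒-total (suc zero)  zero        _   = inj₂ 0⇒1
⇒-total (suc zero)  (suc zero)  i≢j = contradiction refl i≢j
⇒-total (suc zero)  (suc (suc _)) _ = inj₁ 1⇒2
⇒-total (suc (suc _)) zero      _   = inj₁ 2⇒0
⇒-total (suc (suc _)) (suc zero) _  = inj₂ 1⇒2
⇒-total (suc (suc x)) (suc (suc y)) i≢j with Fin.<-cmp x y
... | tri< x<y _ _ = inj₁ (2⇒2 x<y)
... | tri≈ _ x≡y _ = contradiction (cong (λ z → suc (suc z)) x≡y) i≢j
... | tri> _ _ y<x = inj₂ (2⇒2 y<x)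

⇒-out : (i : Fin (3 + k)) → ∃[ j ] i ⇒ j
⇒-out zero          = suc zero , 0⇒1
⇒-out (suc zero)    = suc (suc zero) , 1⇒2
⇒-out (suc (suc _)) = zero , 2⇒0

⇒-in : (j : Fin (3 + k)) → ∃[ i ] i ⇒ j
⇒-in zero          = suc (suc zero) , 2⇒0
⇒-in (suc zero)    = zero , 0⇒1
⇒-in (suc (suc _)) = suc zero , 1⇒2

-- Half-arcs of the tournament, with their stars and pairs.

module HalfArcs (k : ℕ) where

  r : ℕ
  r = 2 + k

  Node : Set
  Node = Fin (suc r)

  isArc? : (e : Node × Node) → _
  isArc? (i , j) = i ⇒? j

  nodes² arcs : List (Node × Node)
  nodes² = cartesianProduct (allFin (suc r)) (allFin (suc r))
  arcs   = filter isArc? nodes²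

  #arcs : ℕ
  #arcs = length arcs

  arc : Fin #arcs → Node × Node
  arc = lookup arcs

  arc-⇒ : ∀ p → uncurry _⇒_ (arc p)
  arc-⇒ p = proj₂ (∈-filter⁻ isArc? {xs = nodes²} (∈-lookup {xs = arcs} p))

  arc-injective : ∀ p q → arc p ≡ arc q → p ≡ q
  arc-injective = lookup-injective
    (Unique.filter⁺ isArc? (Unique.cartesianProduct⁺ (allFin⁺ _) (allFin⁺ _)))

  arc-surjective : ∀ {i j} → i ⇒ j → ∃[ p ] arc p ≡ (i , j)
  arc-surjective {i} {j} i⇒j = index ij∈ , sym (lookup-index ij∈)
    where
    ij∈ : (i , j) List.∈ arcs
    ij∈ = ∈-filter⁺ isArc? (∈-cartesianProduct⁺ (∈-allFin i) (∈-allFin j)) i⇒j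

  -- The second component is `zero` for the half at the tail of the arc and `suc zero` for the half
  -- at its head; it also serves as the colour.
  Half : Set
  Half = Fin #arcs × Fin 2

  -- The node at which a half sits, followed by the other node of its arc.
  ends : Half → Node × Node
  ends (p , zero)  = arc p
  ends (p , suc _) = swap (arc p)

  ends-≢ : ∀ h → proj₁ (ends h) ≢ proj₂ (ends h)
  ends-≢ (p , zero)  eq = ⇒-irrefl (subst (_⇒ proj₂ (arc p)) eq (arc-⇒ p))
  ends-≢ (p , suc _) eq = ⇒-irrefl (subst (proj₁ (arc p) ⇒_) eq (arc-⇒ p))

  -- A tail half and a head half with the same ends would come from opposite arcs, which asymmetry
  -- forbids.
  ends-injective : ∀ h h′ → ends h ≡ ends h′ → h ≡ h′
  ends-injective (p , zero)     (q , zero)     eq = cong (_, zero) (arc-injective p q eq)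
  ends-injective (p , suc zero) (q , suc zero) eq = cong (_, suc zero) (arc-injective p q (cong swap eq))
  ends-injective (p , zero)     (q , suc zero) eq =
    contradiction (arc-⇒ q) (⇒-asym (subst (uncurry _⇒_) eq (arc-⇒ p)))
  ends-injective (p , suc zero) (q , zero)     eq =
    contradiction (arc-⇒ p) (⇒-asym (subst (uncurry _⇒_) (sym eq) (arc-⇒ q)))

  -- By totality an arc joins `i` and `j`; the half at `i` is its tail or its head half according to
  -- the direction.
  ends-surjective : ∀ {i j} → i ≢ j → ∃[ h ] ends h ≡ (i , j)
  ends-surjective {i} {j} i≢j with ⇒-total i j i≢j
  ... | inj₁ i⇒j = let p , eq = arc-surjective i⇒j in (p , zero) , eq
  ... | inj₂ j⇒i = let p , eq = arc-surjective j⇒i in (p , suc zero) , cong swap eq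

  -- Halves are numbered through `combine`, since the vertices of a hypergraph must form some
  -- `Fin n`.
  Vertex : Set
  Vertex = Fin (#arcs * 2)

  half : Vertex → Half
  half = remQuot 2

  vertex : Half → Vertex
  vertex = uncurry combine

  half-vertex : ∀ h → half (vertex h) ≡ h
  half-vertex (p , s) = remQuot-combine p s

  half-injective : ∀ {u v} → half u ≡ half v → u ≡ v
  half-injective {u} {v} eq =
    trans (sym (combine-remQuot {#arcs} 2 u)) (trans (cong vertex eq) (combine-remQuot {#arcs} 2 v))

  star : Vertex → Node
  star = proj₁ ∘ ends ∘ half

  pair : Vertex → Fin #arcs
  pair = proj₁ ∘ half

  colour : Vertex → Fin 2
  colour = proj₂ ∘ half

  -- The two halves of one arc sit at different nodes, so star and pair together single out a half.
  simple : ∀ {u v} → star u ≡ star v → pair u ≡ pair v → u ≡ v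
  simple {u} {v} su≡sv pu≡pv = half-injective (same (half u) (half v) su≡sv pu≡pv)
    where
    same : ∀ h h′ → proj₁ (ends h) ≡ proj₁ (ends h′) → proj₁ h ≡ proj₁ h′ → h ≡ h′
    same (p , zero)     (p , zero)     _  refl = refl
    same (p , suc zero) (p , suc zero) _  refl = refl
    same (p , zero)     (p , suc zero) eq refl = contradiction eq (ends-≢ (p , zero))
    same (p , suc zero) (p , zero)     eq refl = contradiction eq (ends-≢ (p , suc zero))

  colour-≢ : ∀ p q → colour (vertex (p , zero)) ≢ colour (vertex (q , suc zero))
  colour-≢ p q eq = Fin.0≢1+n
    (trans (sym (cong proj₂ (half-vertex (p , zero)))) (trans eq (cong proj₂ (half-vertex (q , suc zero)))))

  pair-bichromatic : ∀ p → ∃₂ λ u v → pair u ≡ p × pair v ≡ p × colour u ≢ colour v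
  pair-bichromatic p = vertex (p , zero) , vertex (p , suc zero) ,
    cong proj₁ (half-vertex (p , zero)) , cong proj₁ (half-vertex (p , suc zero)) , colour-≢ p p

  -- An arc leaving `i` has its tail half there and an arc entering `i` its head half; both exist
  -- because the tournament has no sink and no source.
  star-bichromatic : ∀ i → ∃₂ λ u v → star u ≡ i × star v ≡ i × colour u ≢ colour v
  star-bichromatic i =
    let j  , i⇒j  = ⇒-out i
        j′ , j′⇒i = ⇒-in i
        p , p≡ = arc-surjective i⇒j
        q , q≡ = arc-surjective j′⇒i
    in vertex (p , zero) , vertex (q , suc zero) ,
       trans (cong (proj₁ ∘ ends) (half-vertex (p , zero))) (cong proj₁ p≡) ,
       trans (cong (proj₁ ∘ ends) (half-vertex (q , suc zero))) (cong proj₂ q≡) ,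
       colour-≢ p q

  -- Two of the `r + 1` nodes share a label by pigeonhole. Completeness of the tournament gives an
  -- arc between them, and its two halves form the required pair.
  monochromatic-pair : ∀ (h : Node → Fin r) →
    ∃[ p ] (∀ u v → pair u ≡ p → pair v ≡ p → h (star u) ≡ h (star v))
  monochromatic-pair h with pigeonhole (n<1+n r) h
  ... | i , j , i<j , hi≡hj with ends-surjective (Fin.<⇒≢ i<j)
  ... | (p , s) , ends≡ij = p , λ u v pu pv → trans (h-star u pu) (sym (h-star v pv))
    where
    -- `s` tells which half of `p` sits at `i`. The half `t` sits at `i` if it is on the same side
    -- and at `j` otherwise, and the labels of `i` and `j` agree.
    h-end : ∀ s → ends (p , s) ≡ (i , j) → ∀ t → h (proj₁ (ends (p , t))) ≡ h i
    h-end zero    eq zero    = cong (h ∘ proj₁) eq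
    h-end zero    eq (suc _) = trans (cong (h ∘ proj₂) eq) (sym hi≡hj)
    h-end (suc _) eq zero    = trans (cong (h ∘ proj₂) eq) (sym hi≡hj)
    h-end (suc _) eq (suc _) = cong (h ∘ proj₁) eq
    h-star : ∀ u → pair u ≡ p → h (star u) ≡ h i
    h-star u refl = h-end s ends≡ij (colour u)

  -- Edge sizes.

  to-neighbour : ∀ i (x : Fin r) → ∃[ v ] ends (half v) ≡ (i , punchIn i x)
  to-neighbour i x =
    let h , eq = ends-surjective (punchInᵢ≢i i x ∘ sym)
    in vertex h , trans (cong ends (half-vertex h)) eq

  -- The halves at `i` correspond to the nodes other than `i`, which `punchIn i` enumerates by
  -- `Fin r`.
  ∣star∣ : ∀ i → ∣ fibre star i ∣ ≡ r
  ∣star∣ i = trans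
    (∣p∣≡length {xs = vs} (Unique.map⁺ injective (allFin⁺ r)) λ v → mk⇔ forward backward)
    (trans (length-map nb (allFin r)) (length-tabulate {n = r} (id)))
    where
    nb : Fin r → Vertex
    nb = proj₁ ∘ to-neighbour i
    nb-ends : ∀ x → ends (half (nb x)) ≡ (i , punchIn i x)
    nb-ends = proj₂ ∘ to-neighbour i
    vs : List Vertex
    vs = map nb (allFin r)
    injective : ∀ {x y} → nb x ≡ nb y → x ≡ y
    injective {x} {y} eq = punchIn-injective i x y (cong proj₂
      (trans (sym (nb-ends x)) (trans (cong (ends ∘ half) eq) (nb-ends y))))
    forward : ∀ {v} → v ∈ fibre star i → v List.∈ vs
    forward {v} v∈ with ∈-fibre⁻ star v∈
    -- Matching `refl` replaces `i` by `star v`; `x` is then the index of the opposite end of `v`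
    -- among the nodes other than `star v`.
    ... | refl = subst (List._∈ vs)
          (half-injective (ends-injective _ _
            (trans (nb-ends x) (cong (i ,_) (punchIn-punchOut (ends-≢ (half v)))))))
          (∈-map⁺ nb (∈-allFin x))
      where
      x : Fin r
      x = punchOut (ends-≢ (half v))
    backward : ∀ {v} → v List.∈ vs → v ∈ fibre star i
    backward v∈ with ∈-map⁻ nb v∈
    ... | x , _ , refl = ∈-fibre⁺ star (cong proj₁ (nb-ends x))

  ∣pair∣ : ∀ p → ∣ fibre pair p ∣ ≡ 2
  ∣pair∣ p = ∣p∣≡length {xs = vs} ((distinct ∷ []) ∷ [] ∷ []) λ v → mk⇔ forward backward
    where
    u₀ u₁ : Vertex
    u₀ = vertex (p , zero)
    u₁ = vertex (p , suc zero)
    vs : List Vertex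
    vs = u₀ ∷ u₁ ∷ []
    distinct : u₀ ≢ u₁
    distinct eq = colour-≢ p p (cong colour eq)
    forward : ∀ {v} → v ∈ fibre pair p → v List.∈ vs
    forward {v} v∈ = first-or-second (half v) refl (∈-fibre⁻ pair v∈)
      where
      first-or-second : ∀ h → half v ≡ h → proj₁ h ≡ p → v List.∈ vs
      first-or-second (p , zero)     eq refl =
        here (half-injective (trans eq (sym (half-vertex (p , zero)))))
      first-or-second (p , suc zero) eq refl =
        there (here (half-injective (trans eq (sym (half-vertex (p , suc zero))))))
    backward : ∀ {v} → v List.∈ vs → v ∈ fibre pair p
    backward (here refl)         = ∈-fibre⁺ pair (cong proj₁ (half-vertex (p , zero)))
    backward (there (here refl)) = ∈-fibre⁺ pair (cong proj₁ (half-vertex (p , suc zero)))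

  open Dual star pair public

  maxEdgeSize : Hypergraph.MaxEdgeSize H r
  -- Stars come first in the edge numbering, so edge `zero` is the star of node `zero` and attains
  -- the bound.
  maxEdgeSize = bound , zero , ∣star∣ zero
    where
    bound : ∀ e → ∣ Hypergraph.edge H e ∣ ≤ r
    bound e with splitAt (suc r) e
    ... | inj₁ i = ≤-reflexive (∣star∣ i)
    ... | inj₂ p = ≤-trans (≤-reflexive (∣pair∣ p)) (s≤s (s≤s z≤n))

  bipartite : Hypergraph.Bipartite H
  bipartite = colour , properlyColors colour star-bichromatic pair-bichromatic

mainTheorem2 : ∀ (r : ℕ) → 2 ≤ r →
    Σ[ H ∈ Hypergraph ] (let open Hypergraph H in
    MaxEdgeSize r
    × Linear
    × Regular 2
    × Bipartite
    × (∀ (e : Edge) → ¬ TwinSet (edge e))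
    × ¬ (Σ[ ρ ∈ (Edge → ℕ) ] (IsWeighting r ρ × ProperlyColors (vertexWeight ρ))))
mainTheorem2 (suc (suc k)) (s≤s (s≤s z≤n)) =
  H , maxEdgeSize , linear simple , regular , bipartite , no-twins simple bipartite ,
  no-weighting monochromatic-pair
  where open HalfArcs k
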